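{- Assume $Spr(\beta)$. Then $(\mathcal{F}_\beta,=)\models\forall\mathsf{x}[D(\mathsf{x})]$ (i.e. $\forall\alpha,\gamma\in\mathcal{F}_\beta[\alpha=\gamma\vee\neg(\alpha=\gamma)]$) if and only if there exists $\varphi$ with $\varphi:\mathcal{F}_\beta\hookrightarrow\omega$.
   Context: Intuitionistic mathematics (constructive reading of logical constants; Markov's Principle not assumed). Axioms assumed: Brouwer's Continuity Principle (for every $R\subseteq\mathcal{N}\times\omega$, if $\forall\alpha\exists n[\alpha R n]$ then $\forall\alpha\exists m\exists n\forall\beta[\overline{\alpha}m\sqsubset\beta\rightarrow\beta R n]$) and the First Axiom of Continuous Choice (for every $R\subseteq\mathcal{N}\times\omega$, if $\forall\alpha\exists n[\alpha R n]$ then there is $\varphi:\mathcal{N}\rightarrow\omega$, in the sense defined below with $\mathcal{F}_\beta=\mathcal{N}$, such that $\forall\alpha[\alpha R\varphi(\alpha)]$). $\mathcal{N}=\omega^\omega$; finite sequences are coded by naturals, $\overline{\alpha}p=\langle\alpha(0),\dots,\alpha(p-1)\rangle$, $s\sqsubset\alpha$ means $s$ is an initial segment of $\alpha$. $\mathcal{F}_\beta:=\{\alpha\mid\forall n[\beta(\overline{\alpha}n)=0]\}$; $Spr(\beta)$ iff $\forall s[\beta(s)=0\leftrightarrow\exists n[\beta(s\ast\langle n\rangle)=0]]$. $D(\mathsf{x})$ is the formula $\forall\mathsf{y}[\mathsf{x}=\mathsf{y}\vee\neg(\mathsf{x}=\mathsf{y})]$. For $\varphi\in\mathcal{N}$: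 $\varphi:\mathcal{F}_\beta\rightarrow\omega$ iff $\forall\alpha\in\mathcal{F}_\beta\exists p[\varphi(\overline{\alpha}p)\neq0]$, and then $\varphi(\alpha)$ is the $z$ with $\varphi(\overline{\alpha}q)=z+1$ where $q$ is the least $p$ with $\varphi(\overline{\alpha}p)\neq0$. $\varphi:\mathcal{F}_\beta\hookrightarrow\omega$ iff $\varphi:\mathcal{F}_\beta\rightarrow\omega$ and $\forall\alpha,\delta\in\mathcal{F}_\beta[\alpha\#\delta\rightarrow\varphi(\alpha)\neq\varphi(\delta)]$, where $\alpha\#\delta$ means $\exists n[\alpha(n)\neq\delta(n)]$. -}

module Defs where

open import Data.Empty using (⊥)
open import Data.Fin using (Fin; zero; suc)
open import Data.List using (List; _++_; [_]; length; applyUpTo)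
open import Data.Nat using (ℕ; suc; _<_)
open import Data.Product using (Σ; ∃-syntax; _×_; proj₁)
open import Data.Sum using (_⊎_)
open import Data.Vec.Functional as Vector using (Vector)
open import Function.Bundles using (_↔_; _⇔_; Inverse)
open import Level using (Level; Lift; _⊔_; 0ℓ) renaming (suc to lsuc)
open import Relation.Binary.Bundles using (Setoid)
open import Relation.Binary.Core using (REL)
open import Relation.Binary.Definitions using (_Respectsˡ_)
import Relation.Binary.Construct.On as On
open import Relation.Binary.PropositionalEquality using (_≡_; _≢_; _≗_; _→-setoid_)
open import Relation.Nullary using (Irrelevant)

-- Propositional truncation, in its impredicative encoding.  Every ∃ and every ∨
-- of the informal text is read as ∥ Σ ∥ and ∥ ⊎ ∥.  With untruncated Σ,
-- Brouwer's Continuity Principle would yield a modulus functional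
-- ((ℕ → ℕ) → ℕ) → ℕ and so be refutable in type theory (Escardó), which would
-- make everything assuming it vacuous.
∥_∥ : {a : Level} → Set a → Set (lsuc 0ℓ ⊔ a)
∥ A ∥ = (P : Set) → Irrelevant P → (A → P) → P

𝒩 : Set
𝒩 = ℕ → ℕ

infix 4 _#_

_#_ : 𝒩 → 𝒩 → Set₁
α # δ = ∥ (∃[ n ] α n ≢ δ n) ∥

-- First-order formulas in the language of equality with n free variables
-- (de Bruijn indices), and their intuitionistic Tarski semantics.

infix  8 _≐_
infixr 7 _∧′_
infixr 6 _∨′_
infixr 5 _⇒′_

data Formula (n : ℕ) : Set where
  _≐_            : Fin n → Fin n → Formula n
  ⊥′             : Formula n
  _∧′_ _∨′_ _⇒′_ : Formula n → Formula n → Formula n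
  ∀′ ∃′          : Formula (suc n) → Formula n

¬′_ : {n : ℕ} → Formula n → Formula n
¬′ A = A ⇒′ ⊥′

D : {n : ℕ} → Fin n → Formula n
D x = ∀′ (suc x ≐ zero ∨′ (¬′ (suc x ≐ zero)))

module _ (M : Setoid 0ℓ 0ℓ) where
  open Setoid M

  Sat : {n : ℕ} → Vector Carrier n → Formula n → Set₁
  Sat ρ (x ≐ y)  = Lift (lsuc 0ℓ) (ρ x ≈ ρ y)
  Sat ρ ⊥′       = Lift (lsuc 0ℓ) ⊥
  Sat ρ (A ∧′ B) = Sat ρ A × Sat ρ B
  Sat ρ (A ∨′ B) = ∥ (Sat ρ A ⊎ Sat ρ B) ∥
  Sat ρ (A ⇒′ B) = Sat ρ A → Sat ρ B
  Sat ρ (∀′ A)   = (a : Carrier) → Sat (a Vector.∷ ρ) A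
  Sat ρ (∃′ A)   = ∥ (Σ Carrier λ a → Sat (a Vector.∷ ρ) A) ∥

infix 4 _⊨_

_⊨_ : Setoid 0ℓ 0ℓ → Formula 0 → Set₁
M ⊨ A = Sat M Vector.[] A

-- Everything below is relative to an arbitrary bijective coding of finite
-- sequences of natural numbers by natural numbers.
module Coding (coding : List ℕ ↔ ℕ) where
  open Inverse coding renaming (to to encode; from to decode)

  bar : 𝒩 → ℕ → ℕ
  bar α p = encode (applyUpTo α p)

  infixl 6 _∗⟨_⟩
  infix 4 _⊏_ _∈𝓕_

  _∗⟨_⟩ : ℕ → ℕ → ℕ
  s ∗⟨ n ⟩ = encode (decode s ++ [ n ])

  _⊏_ : ℕ → 𝒩 → Set
  s ⊏ α = bar α (length (decode s)) ≡ s

  _∈𝓕_ : 𝒩 → 𝒩 → Set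
  α ∈𝓕 β = ∀ n → β (bar α n) ≡ 0

  Spr : 𝒩 → Set₁
  Spr β = ∀ s → β s ≡ 0 ⇔ ∥ (∃[ n ] β (s ∗⟨ n ⟩) ≡ 0) ∥

  -- the structure (𝓕_β , =)
  𝓕 : 𝒩 → Setoid 0ℓ 0ℓ
  𝓕 β = On.setoid {B = ∃[ α ] α ∈𝓕 β} (ℕ →-setoid ℕ) proj₁

  _∶𝓕_⟶ω : 𝒩 → 𝒩 → Set₁
  φ ∶𝓕 β ⟶ω = ∀ α → α ∈𝓕 β → ∥ (∃[ p ] φ (bar α p) ≢ 0) ∥

  -- φ ⟨ α ⟩= z is the graph of the partial map α ↦ φ(α).
  _⟨_⟩=_ : 𝒩 → 𝒩 → ℕ → Set₁
  φ ⟨ α ⟩= z =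
    ∥ (∃[ q ] φ (bar α q) ≡ suc z × (∀ p → p < q → φ (bar α p) ≡ 0)) ∥

  _∶𝓕_↪ω : 𝒩 → 𝒩 → Set₁
  φ ∶𝓕 β ↪ω = φ ∶𝓕 β ⟶ω ×
    (∀ α δ → α ∈𝓕 β → δ ∈𝓕 β → α # δ →
     ∀ y z → φ ⟨ α ⟩= y → φ ⟨ δ ⟩= z → y ≢ z)

  -- In the two axioms, a subset of 𝒩 × ω is a type family respecting the
  -- (pointwise) equality of 𝒩, with membership its truncation.

  BCP : Set₂
  BCP = (R : REL 𝒩 ℕ (lsuc 0ℓ)) → R Respectsˡ _≗_ →
    (∀ α → ∥ (∃[ n ] R α n) ∥) →
    ∀ α → ∥ (∃[ m ] ∃[ n ] ∀ β → bar α m ⊏ β → ∥ R β n ∥) ∥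

  -- 𝓕 of the constant zero sequence is all of 𝒩.
  AC₁₀ : Set₂
  AC₁₀ = (R : REL 𝒩 ℕ (lsuc 0ℓ)) → R Respectsˡ _≗_ →
    (∀ α → ∥ (∃[ n ] R α n) ∥) →
    ∥ (∃[ φ ] φ ∶𝓕 (λ _ → 0) ⟶ω × (∀ α z → φ ⟨ α ⟩= z → ∥ R α z ∥)) ∥

{-# OPTIONS --safe #-}
module Submission where

-- From left to right: a spread with β(⟨⟩) = 0 is a retract of 𝒩, so Brouwer's
-- Continuity Principle applies on it.  Applied at α to the decision α = γ ∨ ¬(α = γ)
-- it shows that α is isolated: some initial segment of α has no other
-- continuation in 𝓕_β.  Continuous choice selects such a segment for every α, and
-- an isolating segment determines the point it isolates, so the selection is
-- injective.  From right to left: compare the values φ(α) and φ(γ).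

open import Defs
open import Data.Empty using (⊥)
open import Data.Fin using (zero)
open import Data.List using (List; []; _∷ʳ_; length; applyUpTo)
open import Data.List.Properties using (length-applyUpTo; applyUpTo-∷ʳ)
open import Data.Nat using (ℕ; zero; suc; _<_; _≟_)
open import Data.Nat.Properties using (<-cmp; ≡-irrelevant; suc-injective; anyUpTo?)
open import Data.Nat.Induction using (<-rec)
open import Data.Product using (∃-syntax; _×_; _,_; proj₁; proj₂)
open import Data.Refinement using (Refinement-syntax; _,_)
open import Data.Irrelevant using ([_])
open import Data.Sum using (_⊎_; inj₁; inj₂)
open import Function.Bundles using (_↔_; _⇔_; mk⇔; Equivalence; Inverse)
open import Level using (Level; Lift; lift; lower; 0ℓ) renaming (suc to lsuc)
open import Relation.Binary.Core using (REL)
open import Relation.Binary.Definitions using (_Respectsˡ_; tri<; tri≈; tri>)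
open import Relation.Binary.PropositionalEquality using (_≡_; _≢_; _≗_; refl; sym; trans; cong; cong₂; module ≡-Reasoning)
open import Relation.Nullary using (yes; no; ¬_; ¬?; Irrelevant; contradiction; recompute)
open import Relation.Nullary.Decidable using (decidable-stable)
open import Relation.Unary using (Pred; Decidable)

private
  variable
    a b : Level
    A : Set a
    B : Set b

∣_∣ₜ : A → ∥ A ∥
∣ x ∣ₜ P irr k = k x

infixl 1 _>>=ₜ_

_>>=ₜ_ : ∥ A ∥ → (A → ∥ B ∥) → ∥ B ∥
(t >>=ₜ f) P irr k = t P irr (λ x → f x P irr k)

∥-∥-⊥ : ∥ A ∥ → ¬ ¬ A
∥-∥-⊥ t = t ⊥ (λ ())

-- Equations between naturals are propositions, so a truncated hypothesis may be opened to prove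
-- one.
∥-∥-≡ : {m n : ℕ} → ∥ A ∥ → (A → m ≡ n) → m ≡ n
∥-∥-≡ t = t _ ≡-irrelevant

IsLeast : Pred ℕ 0ℓ → Pred ℕ 0ℓ
IsLeast P n = P n × (∀ m → m < n → ¬ P m)

IsLeast-unique : ∀ {P m n} → IsLeast P m → IsLeast P n → m ≡ n
IsLeast-unique {m = m} {n} (Pm , min-m) (Pn , min-n) with <-cmp m n
... | tri< m<n _ _ = contradiction Pm (min-n m m<n)
... | tri≈ _ m≡n _ = m≡n
... | tri> _ _ n<m = contradiction Pn (min-m n n<m)

least : ∀ {P} → Decidable P → ∀ n → P n → ∃[ m ] IsLeast P m
least {P} P? = <-rec _ step
  where
  step : ∀ n → (∀ {k} → k < n → P k → ∃[ m ] IsLeast P m) → P n → ∃[ m ] IsLeast P m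
  step n rec Pn with anyUpTo? P? n
  ... | yes (k , k<n , Pk) = rec k<n Pk
  ... | no ∄k = n , Pn , λ m m<n Pm → ∄k (m , m<n , Pm)

-- The minimality proofs of two least witnesses cannot be identified without
-- function extensionality, hence the refinement type with its irrelevant proof.
untruncate : ∀ {P} → Decidable P → ∥ (∃[ n ] P n) ∥ → ∃[ n ] P n
untruncate {P} P? t = unpack (t Least Least-irrelevant pack)
  where
  Least : Set
  Least = [ n ∈ ℕ ∣ IsLeast P n ]

  Least-irrelevant : Irrelevant Least
  Least-irrelevant (m , [ p ]) (n , [ q ])
    with refl ← recompute (m ≟ n) (IsLeast-unique p q) = refl

  pack : ∃[ n ] P n → Least
  pack (n , Pn) = let m , p = least P? n Pn in m , [ p ]

  unpack : Least → ∃[ n ] P n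
  unpack (n , [ p ]) = n , recompute (P? n) (proj₁ p)

module _ (coding : List ℕ ↔ ℕ) where
  open Coding coding
  open Inverse coding using (strictlyInverseʳ) renaming (to to encode; from to decode)

  bar-suc : ∀ α n → bar α (suc n) ≡ bar α n ∗⟨ α n ⟩
  bar-suc α n = begin
    encode (applyUpTo α (suc n))       ≡⟨ cong encode (applyUpTo-∷ʳ α n) ⟨
    encode (applyUpTo α n ∷ʳ α n)      ≡⟨ cong (λ l → encode (l ∷ʳ α n)) (strictlyInverseʳ _) ⟨
    encode (decode (bar α n) ∷ʳ α n)   ∎
    where open ≡-Reasoning

  bar-cong : ∀ {α γ} → α ≗ γ → bar α ≗ bar γ
  bar-cong α≗γ zero = refl
  bar-cong {α} {γ} α≗γ (suc n) = begin
    bar α (suc n)        ≡⟨ bar-suc α n ⟩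
    bar α n ∗⟨ α n ⟩     ≡⟨ cong₂ _∗⟨_⟩ (bar-cong α≗γ n) (α≗γ n) ⟩
    bar γ n ∗⟨ γ n ⟩     ≡⟨ bar-suc γ n ⟨
    bar γ (suc n)        ∎
    where open ≡-Reasoning

  bar-⊏ : ∀ α n → bar α n ⊏ α
  bar-⊏ α n = cong (bar α) (trans (cong length (strictlyInverseʳ _)) (length-applyUpTo α n))

  ⊏-resp-≗ : ∀ {s α γ} → α ≗ γ → s ⊏ α → s ⊏ γ
  ⊏-resp-≗ α≗γ s⊏α = trans (sym (bar-cong α≗γ _)) s⊏α

  -- Whether `φ` vanishes at a code is decidable, so the truncation can be left; an untruncated
  -- value is what a case analysis on values needs.
  value-exists : ∀ φ α → ∥ (∃[ p ] φ (bar α p) ≢ 0) ∥ → ∃[ z ] φ ⟨ α ⟩= z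
  value-exists φ α t with untruncate (λ p → ¬? (φ (bar α p) ≟ 0)) t
  ... | p , φp≢0 with least (λ p → ¬? (φ (bar α p) ≟ 0)) p φp≢0
  ... | q , φq≢0 , min with φ (bar α q) in eq
  ... | zero  = contradiction refl φq≢0
  ... | suc z = z , ∣ q , eq , (λ p p<q → decidable-stable (φ (bar α p) ≟ 0) (min p p<q)) ∣ₜ

  -- `φ` sees only codes of initial segments, and these agree for pointwise equal sequences, so the
  -- first nonzero positions coincide.
  value-unique : ∀ φ {α γ y z} → α ≗ γ → φ ⟨ α ⟩= y → φ ⟨ γ ⟩= z → y ≡ z
  value-unique φ {α} {γ} {y} {z} α≗γ s t = ∥-∥-≡ s λ u → ∥-∥-≡ t λ v → go u v
    where
    φ≗ : ∀ p → φ (bar α p) ≡ φ (bar γ p)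
    φ≗ p = cong φ (bar-cong α≗γ p)

    go : ∃[ q ] φ (bar α q) ≡ suc y × (∀ p → p < q → φ (bar α p) ≡ 0) →
         ∃[ r ] φ (bar γ r) ≡ suc z × (∀ p → p < r → φ (bar γ p) ≡ 0) → y ≡ z
    go (q , φq , min-q) (r , φr , min-r) with <-cmp q r
    ... | tri< q<r _ _ = contradiction (trans (sym φq) (trans (φ≗ q) (min-r q q<r))) λ ()
    ... | tri≈ _ refl _ = suc-injective (trans (sym φq) (trans (φ≗ q) φr))
    ... | tri> _ _ r<q = contradiction (trans (sym φr) (trans (sym (φ≗ r)) (min-q r r<q))) λ ()

  injection⇒decidable : ∀ β φ → φ ∶𝓕 β ↪ω → 𝓕 β ⊨ ∀′ (D zero)
  injection⇒decidable β φ (total , injective) (α , α∈) (γ , γ∈)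
    with value-exists φ α (total α α∈) | value-exists φ γ (total γ γ∈)
  ... | y , φα=y | z , φγ=z with y ≟ z
  ... | no y≢z = ∣ inj₂ (λ (lift α≗γ) → contradiction (value-unique φ α≗γ φα=y φγ=z) y≢z) ∣ₜ
  -- A place where `α` and `γ` differ would make the values distinct; stability of equality on `ℕ`
  -- turns its absence into `α n ≡ γ n`.
  ... | yes y≡z = ∣ inj₁ (lift λ n → decidable-stable (α n ≟ γ n) λ αn≢γn →
                    injective α γ α∈ γ∈ ∣ n , αn≢γn ∣ₜ y z φα=y φγ=z y≡z) ∣ₜ

  module Retraction (β : 𝒩) (spr : Spr β) (root : β (encode []) ≡ 0) where

    child : ∀ s → β s ≡ 0 → ∃[ n ] β (s ∗⟨ n ⟩) ≡ 0
    child s βs = untruncate (λ n → β (s ∗⟨ n ⟩) ≟ 0) (Equivalence.to (spr s) βs)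

    -- The value 0 is junk: it is taken only at s with β s ≢ 0.
    next : ℕ → ℕ → ℕ
    next s n with β (s ∗⟨ n ⟩) ≟ 0 | β s ≟ 0
    ... | yes _ | _      = n
    ... | no  _ | yes βs = proj₁ (child s βs)
    ... | no  _ | no  _  = 0

    next-admissible : ∀ s n → β s ≡ 0 → β (s ∗⟨ next s n ⟩) ≡ 0
    next-admissible s n βs with β (s ∗⟨ n ⟩) ≟ 0 | β s ≟ 0
    ... | yes βsn | _       = βsn
    ... | no  _   | yes βs′ = proj₂ (child s βs′)
    ... | no  _   | no ¬βs  = contradiction βs ¬βs

    next-fixes : ∀ s n → β (s ∗⟨ n ⟩) ≡ 0 → next s n ≡ n
    next-fixes s n βsn with β (s ∗⟨ n ⟩) ≟ 0 | β s ≟ 0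
    ... | yes _   | _ = refl
    ... | no ¬βsn | _ = contradiction βsn ¬βsn

    -- Code of the corrected copy of `α`: each entry is kept if it extends the copy within the
    -- spread, and otherwise replaced by an admissible one.
    segment : 𝒩 → ℕ → ℕ
    segment α zero    = encode []
    segment α (suc n) = segment α n ∗⟨ next (segment α n) (α n) ⟩

    retract : 𝒩 → 𝒩
    retract α n = next (segment α n) (α n)

    bar-retract : ∀ α n → bar (retract α) n ≡ segment α n
    bar-retract α zero    = refl
    bar-retract α (suc n) =
      trans (bar-suc (retract α) n) (cong (_∗⟨ retract α n ⟩) (bar-retract α n))

    retract-∈ : ∀ α → retract α ∈𝓕 β
    retract-∈ α n = trans (cong β (bar-retract α n)) (admissible n)
      where
      admissible : ∀ n → β (segment α n) ≡ 0
      admissible zero    = root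
      admissible (suc n) = next-admissible (segment α n) (α n) (admissible n)

    retract-cong : ∀ {α γ} → α ≗ γ → retract α ≗ retract γ
    retract-cong {α} {γ} α≗γ n = cong₂ next (segment-cong n) (α≗γ n)
      where
      segment-cong : segment α ≗ segment γ
      segment-cong zero    = refl
      segment-cong (suc n) = cong₂ _∗⟨_⟩ (segment-cong n)
        (cong₂ next (segment-cong n) (α≗γ n))

    retract-fixes : ∀ {α} → α ∈𝓕 β → retract α ≗ α
    retract-fixes {α} α∈ n =
      trans (cong (λ s → next s (α n)) (segment-bar n)) (next-bar n)
      where
      next-bar : ∀ n → next (bar α n) (α n) ≡ α n
      next-bar n = next-fixes (bar α n) (α n) (trans (cong β (sym (bar-suc α n))) (α∈ (suc n)))

      segment-bar : segment α ≗ bar α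
      segment-bar zero    = refl
      -- Nothing has been corrected so far, and `α∈` makes the next entry of `α` admissible, so it
      -- is kept too.
      segment-bar (suc n) rewrite segment-bar n | next-bar n = sym (bar-suc α n)

  -- The number `s` codes the segment itself, not its length: different points may be isolated at
  -- the same length, but never by the same segment.
  Isolates : 𝒩 → ℕ → 𝒩 → Set
  Isolates β s α = s ⊏ α × (∀ γ → γ ∈𝓕 β → s ⊏ γ → γ ≗ α)

  Isolates-resp-≗ : ∀ β {s α γ} → α ≗ γ → Isolates β s α → Isolates β s γ
  Isolates-resp-≗ β α≗γ (s⊏α , unique) =
    ⊏-resp-≗ α≗γ s⊏α , λ δ δ∈ s⊏δ n → trans (unique δ δ∈ s⊏δ n) (α≗γ n)

  module _ (β : 𝒩) (spr : Spr β) (root : β (encode []) ≡ 0) where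
    open Retraction β spr root

    isolated : BCP → 𝓕 β ⊨ ∀′ (D zero) → ∀ α → α ∈𝓕 β → ∥ (∃[ s ] Isolates β s α) ∥
    isolated bcp dec α α∈ = bcp R R-resp R-total α >>=ₜ isolate
      where
      R : REL 𝒩 ℕ (lsuc 0ℓ)
      -- The axiom quantifies over all of `𝒩`, so `γ` is first retracted into the spread; 0 and 1
      -- code the two outcomes of the decision.
      R γ n = Lift _ ((n ≡ 0 × α ≗ retract γ) ⊎ (n ≡ 1 × ¬ (α ≗ retract γ)))

      R-resp : R Respectsˡ _≗_
      R-resp γ≗δ (lift (inj₁ (n≡0 , eq))) =
        lift (inj₁ (n≡0 , λ k → trans (eq k) (retract-cong γ≗δ k)))
      R-resp γ≗δ (lift (inj₂ (n≡1 , neq))) =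
        lift (inj₂ (n≡1 , λ eq → neq λ k → trans (eq k) (sym (retract-cong γ≗δ k))))

      R-total : ∀ γ → ∥ (∃[ n ] R γ n) ∥
      R-total γ = dec (α , α∈) (retract γ , retract-∈ γ) >>=ₜ λ where
        (inj₁ (lift eq)) → ∣ 0 , lift (inj₁ (refl , eq)) ∣ₜ
        (inj₂ neq)       → ∣ 1 , lift (inj₂ (refl , λ eq → lower (neq (lift eq)))) ∣ₜ

      isolate : ∃[ m ] ∃[ n ] (∀ γ → bar α m ⊏ γ → ∥ R γ n ∥) → ∥ (∃[ s ] Isolates β s α) ∥
      isolate (m , n , cont) = ∣ bar α m , bar-⊏ α m , unique ∣ₜ
        where
        n≡0 : n ≡ 0
        -- `α` lies in its own neighbourhood and is fixed by `retract`, which forces the common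
        -- outcome to be equality.
        n≡0 = ∥-∥-≡ (cont α (bar-⊏ α m)) λ where
          (lift (inj₁ (n≡0 , _))) → n≡0
          (lift (inj₂ (_ , neq))) → contradiction (λ k → sym (retract-fixes α∈ k)) neq

        unique : ∀ γ → γ ∈𝓕 β → bar α m ⊏ γ → γ ≗ α
        unique γ γ∈ s⊏γ k = ∥-∥-≡ (cont γ s⊏γ) λ where
          (lift (inj₁ (_ , eq)))  → sym (trans (eq k) (retract-fixes γ∈ k))
          (lift (inj₂ (n≡1 , _))) → contradiction (trans (sym n≡0) n≡1) λ ()

    decidable⇒injection : BCP → AC₁₀ → 𝓕 β ⊨ ∀′ (D zero) → ∥ (∃[ φ ] φ ∶𝓕 β ↪ω) ∥
    decidable⇒injection bcp ac dec = ac R R-resp R-total >>=ₜ λ where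
        (φ , total , select) → ∣ φ , (λ α _ → total α (λ _ → refl)) , injective φ select ∣ₜ
      where
      R : REL 𝒩 ℕ (lsuc 0ℓ)
      R α s = Lift _ (Isolates β s (retract α))

      R-resp : R Respectsˡ _≗_
      R-resp α≗γ (lift iso) = lift (Isolates-resp-≗ β (retract-cong α≗γ) iso)

      R-total : ∀ α → ∥ (∃[ s ] R α s) ∥
      R-total α = isolated bcp dec (retract α) (retract-∈ α) >>=ₜ λ where
        (s , iso) → ∣ s , lift iso ∣ₜ

      injective : ∀ φ → (∀ α s → φ ⟨ α ⟩= s → ∥ R α s ∥) →
        ∀ α δ → α ∈𝓕 β → δ ∈𝓕 β → α # δ → ∀ y z → φ ⟨ α ⟩= y → φ ⟨ δ ⟩= z → y ≢ z
      injective φ select α δ α∈ δ∈ α#δ s .s φα=s φδ=s refl =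
        ∥-∥-⊥ (select α s φα=s) λ (lift isoα) →
        ∥-∥-⊥ (select δ s φδ=s) λ (lift isoδ) →
        ∥-∥-⊥ α#δ λ (n , αn≢δn) →
        -- `δ` passes through the segment `s`, which isolates `α`, so `δ` agrees with `α` at `n`.
        αn≢δn (sym (proj₂ (Isolates-resp-≗ β (retract-fixes α∈) isoα) δ δ∈
                          (proj₁ (Isolates-resp-≗ β (retract-fixes δ∈) isoδ)) n))

theorem5p11 : (coding : List ℕ ↔ ℕ) → let open Coding coding in
    BCP → AC₁₀ →
    (β : 𝒩) → Spr β →
    (𝓕 β ⊨ ∀′ (D zero)) ⇔ ∥ (∃[ φ ] φ ∶𝓕 β ↪ω) ∥
theorem5p11 coding bcp ac β spr = mk⇔ injection decide
  where
  open Coding coding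

  injection : 𝓕 β ⊨ ∀′ (D zero) → ∥ (∃[ φ ] φ ∶𝓕 β ↪ω) ∥
  injection dec with β (Inverse.to coding []) ≟ 0
  ... | yes root = decidable⇒injection coding β spr root bcp ac dec
  -- Every sequence starts with the empty segment, so here the spread has no members and any `φ`
  -- will do.
  ... | no ¬root = ∣ (λ _ → 0) , (λ α α∈ → contradiction (α∈ 0) ¬root)
                   , (λ α _ α∈ → contradiction (α∈ 0) ¬root) ∣ₜ

  decide : ∥ (∃[ φ ] φ ∶𝓕 β ↪ω) ∥ → 𝓕 β ⊨ ∀′ (D zero)
  -- With `a` and `b` given, the goal is a truncated disjunction, so `t` may be opened.
  decide t a b = t >>=ₜ λ (φ , inj) → injection⇒decidable coding β φ inj a b
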